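{- Let $n\geqslant 7$ and let $C_n^2$ be the square of the cycle $C_n$ of length $n$. Then $C_n^2$ is fully orientable.
   Context: All graphs are simple. $C_n=v_0v_1\cdots v_{n-1}v_0$ denotes the cycle of length $n$. For a connected graph $G$, its square $G^2$ has vertex set $V(G)$, and two distinct vertices are adjacent in $G^2$ if and only if their distance in $G$ is at most $2$. An orientation of a graph $G$ assigns a direction to each edge; it is acyclic if it contains no directed cycle. In an acyclic orientation $D$ of $G$, an arc is called dependent if reversing it (keeping all other arcs) creates a directed cycle; $d(D)$ denotes the number of dependent arcs of $D$. Let $d_{\min}(G)$ and $d_{\max}(G)$ be the minimum and maximum of $d(D)$ over all acyclic orientations $D$ of $G$. The graph $G$ is fully orientable if for every integer $k$ with $d_{\min}(G)\leqslant k\leqslant d_{\max}(G)$ there is an acyclic orientation $D$ of $G$ with $d(D)=k$. -}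

module Defs where

open import Data.Nat using (ℕ; zero; suc; _≤_; _∸_)
open import Data.Fin using (Fin; toℕ; _≟_)
open import Data.Fin.Properties using () renaming (_≟_ to _≟ᶠ_)
open import Data.Bool using (Bool; true; false; if_then_else_)
open import Data.Product using (Σ; ∃; _×_; _,_)
open import Data.Sum using (_⊎_)
open import Data.List using (List; length)
open import Data.List.Relation.Unary.Unique.Propositional using (Unique)
open import Data.List.Membership.Propositional using (_∈_)
open import Function.Bundles using (_⇔_)
open import Relation.Binary.PropositionalEquality using (_≡_; _≢_)
open import Relation.Nullary using (¬_; does)
open import Data.Bool using (_∧_)

Rel : ℕ → Set₁
Rel n = Fin n → Fin n → Set

cycleStep : (n : ℕ) → Rel n
cycleStep n u v = (toℕ v ≡ suc (toℕ u)) ⊎ ((toℕ u ≡ n ∸ 1) × (toℕ v ≡ 0))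

cycleAdj : (n : ℕ) → Rel n
cycleAdj n u v = cycleStep n u v ⊎ cycleStep n v u

square : {n : ℕ} → Rel n → Rel n
square Adj u v = (u ≢ v) × (Adj u v ⊎ (∃ λ w → Adj u w × Adj w v))

-- An orientation: o u v ≡ true means the arc u → v is present.
Dir : ℕ → Set
Dir n = Fin n → Fin n → Bool

IsOrientation : {n : ℕ} → Rel n → Dir n → Set
IsOrientation {n} Adj o =
  ((u v : Fin n) → Adj u v →
      ((o u v ≡ true) × (o v u ≡ false)) ⊎ ((o u v ≡ false) × (o v u ≡ true)))
  × ((u v : Fin n) → ¬ Adj u v → o u v ≡ false)

record DirCycle {n : ℕ} (o : Dir n) : Set where
  field
    m      : ℕ
    m≥1    : 1 ≤ m
    w      : Fin (suc m) → Fin n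
    inj    : (i j : Fin (suc m)) → w i ≡ w j → i ≡ j
    step   : (i : Fin (suc m)) (j : Fin (suc m)) → suc (toℕ i) ≡ toℕ j → o (w i) (w j) ≡ true
    close  : (i : Fin (suc m)) → toℕ i ≡ m → (j : Fin (suc m)) → toℕ j ≡ 0 → o (w i) (w j) ≡ true

Acyclic : {n : ℕ} → Dir n → Set
Acyclic o = ¬ DirCycle o

reverseArc : {n : ℕ} → Dir n → Fin n → Fin n → Dir n
reverseArc o u v x y =
  if does (x ≟ᶠ u) ∧ does (y ≟ᶠ v) then false
  else if does (x ≟ᶠ v) ∧ does (y ≟ᶠ u) then true
  else o x y

Dependent : {n : ℕ} → Dir n → Fin n → Fin n → Set
Dependent o u v = (o u v ≡ true) × DirCycle (reverseArc o u v)

NumDependent : {n : ℕ} → Dir n → ℕ → Set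
NumDependent {n} o k =
  Σ (List (Fin n × Fin n)) λ l →
    Unique l × ((p : Fin n × Fin n) → (p ∈ l) ⇔ Dependent o (Data.Product.proj₁ p) (Data.Product.proj₂ p))
    × (length l ≡ k)

Attained : {n : ℕ} → Rel n → ℕ → Set
Attained {n} Adj k = Σ (Dir n) λ o → IsOrientation Adj o × Acyclic o × NumDependent o k

IsDmin : {n : ℕ} → Rel n → ℕ → Set
IsDmin Adj a = Attained Adj a × (∀ k → Attained Adj k → a ≤ k)

IsDmax : {n : ℕ} → Rel n → ℕ → Set
IsDmax Adj b = Attained Adj b × (∀ k → Attained Adj k → k ≤ b)

FullyOrientable : {n : ℕ} → Rel n → Set
FullyOrientable Adj =
  (a b : ℕ) → IsDmin Adj a → IsDmax Adj b →
  (k : ℕ) → a ≤ k → k ≤ b → Attained Adj k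

{-# OPTIONS --safe #-}
-- A minimum or a maximum is attained by hypothesis, so only values strictly between two attained
-- ones need an orientation.  Let T_i be the triangle i, i+1, i+2 (mod n).
--
-- Upper bound n + 1: the n-vertex graph has 2n arcs, and the independent ones connect it.
--
-- Lower bound (n + 1) / 2: the arc from the source to the sink of each T_i is dependent, and
-- serves at most two triangles.  If there were only n / 2 dependent arcs, each would serve exactly
-- two, hence be a rim edge {i, i+1} serving T_{i-1} and T_i; orienting these triangles one after
-- the other yields an endless walk i, i+2, i+4, … (or its reverse).
--
-- Remaining values n - t with 2t + 3 ≤ n: order the vertices by reversed blocks, one of size 3,
-- then t of size 2, then singletons, and direct every edge upwards.  Exactly the arcs from source to
-- sink of the triangles are dependent, and t of them serve two triangles.
module Submission where

open import Defs
open import Data.Nat as ℕ using (ℕ; zero; suc; _+_; _*_; _≤_; _<_; z≤n; s≤s; s≤s⁻¹; NonZero; z<s)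
open import Data.Nat.Properties as ℕₚ
  using (≤-refl; ≤-trans; ≤-reflexive; +-suc; +-comm; m≤m+n; m≤n+m; +-monoʳ-≤; +-monoˡ-≤; n≤1+n;
    +-identityʳ)
open import Data.Fin using (Fin; zero; suc; toℕ; punchIn; punchOut; fromℕ<)
open import Data.Fin.Properties as Finₚ
  using (injective⇒≤; punchInᵢ≢i; punchOut-cong; punchOut-punchIn; toℕ<n; toℕ-injective;
    toℕ-fromℕ<)
open import Data.Bool as Bool using (Bool; true; false; if_then_else_)
open import Data.Product using (Σ; ∃; ∃₂; _×_; _,_; proj₁; proj₂)
open import Data.Sum as Sum using (_⊎_; inj₁; inj₂; [_,_]′)
open import Data.List using (List; []; _∷_; _++_; length; filter; map; concatMap; allFin; upTo)
open import Data.List.Properties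
  using (length-++; length-map; length-tabulate; length-upTo; map-∘; map-id-local)
open import Data.List.Relation.Unary.Any using (here; there)
open import Data.List.Relation.Unary.All as All using (All; []; _∷_)
open import Data.List.Relation.Unary.AllPairs using ([]; _∷_)
open import Data.List.Relation.Unary.Unique.Propositional using (Unique)
open import Data.List.Relation.Unary.Unique.Propositional.Properties as Uniqueₚ
  using (Unique[x∷xs]⇒x∉xs; allFin⁺; upTo⁺)
open import Data.List.Relation.Binary.Subset.Propositional using (_⊆_)
open import Data.List.Membership.Propositional using (_∈_; lose)
open import Data.List.Membership.Propositional.Properties
  using (∈-∃++; ∈-++⁺ˡ; ∈-++⁺ʳ; ∈-++⁻; ∈-filter⁺; ∈-allFin; ∈-map⁻; ∈-map⁺; ∈-concatMap⁺;
    ∈-upTo⁺; ∈-upTo⁻)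
open import Function using (_∘_)
open import Relation.Binary.PropositionalEquality
  using (_≡_; _≢_; refl; sym; trans; cong; cong₂; subst; subst₂)
open import Relation.Nullary using (¬_; yes; no; contradiction; does; Dec)
open import Relation.Unary using (Decidable)
open import Relation.Unary.Properties using (∁?)
open import Data.Empty using (⊥; ⊥-elim)
open import Data.Nat.DivMod
  using (_%_; m%n<n; m<n⇒m%n≡m; n%n≡0; [m+n]%n≡m%n; %-distribˡ-+; m%n%n≡m%n)
open import Data.Product.Properties using (≡-dec; ,-injective)
import Data.List.Relation.Unary.All.Properties as Allₚ
open import Relation.Nullary.Decidable using (_⊎-dec_; _×-dec_; dec-true)
import Data.List.Membership.DecPropositional as DecMembership
open import Function.Bundles using (Equivalence; _⇔_; mk⇔)
open import Data.Nat.Solver using (module +-*-Solver)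
open import Data.Bool.Properties using (¬-not)

-- Counting with duplicate-free lists, and labels glued along pairs.

unique-⊆-length : ∀ {A : Set} {xs ys : List A} → Unique xs → xs ⊆ ys → length xs ≤ length ys
unique-⊆-length {xs = []} _ _ = z≤n
unique-⊆-length {xs = x ∷ xs} u@(_ ∷ uxs) sub with ∈-∃++ (sub (here refl))
... | as , bs , refl = ≤-trans (s≤s (unique-⊆-length uxs sub′)) (≤-reflexive (sym eq))
  where
  eq : length (as ++ x ∷ bs) ≡ suc (length (as ++ bs))
  eq = trans (length-++ as) (trans (+-suc _ _) (cong suc (sym (length-++ as))))
  sub′ : xs ⊆ as ++ bs
  sub′ y∈xs with ∈-++⁻ as (sub (there y∈xs))
  ... | inj₁ p = ∈-++⁺ˡ p
  ... | inj₂ (here refl) = contradiction y∈xs (Unique[x∷xs]⇒x∉xs u)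
  ... | inj₂ (there p) = ∈-++⁺ʳ as p

length-filter-split : ∀ {A : Set} {P : A → Set} (P? : Decidable P) xs →
  length (filter P? xs) + length (filter (∁? P?) xs) ≡ length xs
length-filter-split P? [] = refl
length-filter-split P? (x ∷ xs) with P? x
... | yes _ = cong suc (length-filter-split P? xs)
... | no _ = trans (+-suc _ _) (cong suc (length-filter-split P? xs))

-- Merging the two ends of one pair costs at most one label.
merge-labels : ∀ {n} (E : List (Fin n × Fin n)) →
  ∃ λ m → n ≤ m + length E × Σ (Fin n → Fin m) λ f →
    (∀ a → ∃ λ u → f u ≡ a) × (∀ {u v} → (u , v) ∈ E → f u ≡ f v)
merge-labels {n} [] = n , ≤-reflexive (sym (+-identityʳ n)) , (λ u → u) , (λ a → a , refl) , λ ()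
merge-labels {n} ((x , y) ∷ E) with merge-labels E
... | m , bound , f , onto , const with f x Finₚ.≟ f y
... | yes eq = m , ≤-trans bound (+-monoʳ-≤ m (n≤1+n _)) , f , onto , const′
  where
  const′ : ∀ {u v} → (u , v) ∈ (x , y) ∷ E → f u ≡ f v
  const′ (here refl) = eq
  const′ (there p) = const p
merge-labels ((x , y) ∷ E) | zero , _ , f , _ | no _ with () ← f x
merge-labels {n} ((x , y) ∷ E) | suc m , bound , f , onto , const | no neq =
  m , ≤-trans bound (≤-reflexive (sym (+-suc m _))) , (g ∘ f) , onto′ , const′
  where
  -- The label `f y` is dropped: its vertices take over the label of `f x`, and the other labels
  -- close the gap.
  g : Fin (suc m) → Fin m
  g a with f y Finₚ.≟ a
  ... | yes _ = punchOut (neq ∘ sym)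
  ... | no p = punchOut p
  g-punchIn : ∀ b → g (punchIn (f y) b) ≡ b
  g-punchIn b with f y Finₚ.≟ punchIn (f y) b
  ... | yes q = contradiction (sym q) (punchInᵢ≢i (f y) b)
  ... | no p = trans (punchOut-cong (f y) refl) (punchOut-punchIn (f y))
  onto′ : ∀ b → ∃ λ u → g (f u) ≡ b
  onto′ b with onto (punchIn (f y) b)
  ... | u , eq = u , trans (cong g eq) (g-punchIn b)
  g-glues : g (f x) ≡ g (f y)
  g-glues with f y Finₚ.≟ f x | f y Finₚ.≟ f y
  ... | yes q | _ = contradiction (sym q) neq
  ... | no _ | no q = contradiction refl q
  ... | no _ | yes _ = punchOut-cong (f y) refl
  const′ : ∀ {u v} → (u , v) ∈ (x , y) ∷ E → g (f u) ≡ g (f v)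
  const′ (here refl) = g-glues
  const′ (there p) = cong g (const p)

-- Walks of a given length in a relation.

infixr 5 _◅_

data Walk {n : ℕ} (R : Rel n) : ℕ → Fin n → Fin n → Set where
  ε   : ∀ {u} → Walk R 0 u u
  _◅_ : ∀ {k u v w} → R u v → Walk R k v w → Walk R (suc k) u w

module _ {n : ℕ} {R : Rel n} where

  infixr 5 _◅◅_
  _◅◅_ : ∀ {j k u v w} → Walk R j u v → Walk R k v w → Walk R (j + k) u w
  ε ◅◅ q = q
  (r ◅ p) ◅◅ q = r ◅ (p ◅◅ q)

  unsnoc : ∀ {k u v} → Walk R (suc k) u v → ∃ λ w → Walk R k u w × R w v
  unsnoc (r ◅ ε) = _ , ε , r
  unsnoc (r ◅ p@(_ ◅ _)) with unsnoc p
  ... | w , q , s = w , (r ◅ q) , s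

  at : ∀ {k u v} → Walk R k u v → Fin (suc k) → Fin n
  at {u = u} p zero = u
  at (r ◅ p) (suc i) = at p i

  at-step : ∀ {k u v} (p : Walk R k u v) i j → suc (toℕ i) ≡ toℕ j → R (at p i) (at p j)
  at-step (r ◅ p) zero (suc zero) _ = r
  at-step (r ◅ p) (suc i) (suc j) eq = at-step p i j (cong ℕ.pred eq)

  at-last : ∀ {k u v} (p : Walk R k u v) i → toℕ i ≡ k → at p i ≡ v
  at-last ε zero _ = refl
  at-last (r ◅ p) (suc i) eq = at-last p i (cong ℕ.pred eq)

  take-walk : ∀ {k u v} (p : Walk R k u v) i → Walk R (toℕ i) u (at p i)
  take-walk p zero = ε
  take-walk (r ◅ p) (suc i) = r ◅ take-walk p i

  NoClosedWalk : Set
  NoClosedWalk = ∀ {k u} → ¬ Walk R (suc k) u u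

  -- A repeated vertex cuts out a closed walk no longer than the given walk. Excluding only closed
  -- walks of at most `k` steps keeps this usable on a shortest closed walk.
  at-injective : ∀ {k u v} → (∀ {j u} → j < k → ¬ Walk R (suc j) u u) →
                 (p : Walk R k u v) → ∀ {i j} → at p i ≡ at p j → i ≡ j
  at-injective closed p {zero} {zero} eq = refl
  at-injective closed p@(_ ◅ _) {zero} {suc j} eq =
    ⊥-elim (closed (Finₚ.toℕ<n j) (subst (Walk R _ _) (sym eq) (take-walk p (suc j))))
  at-injective closed p@(_ ◅ _) {suc j} {zero} eq =
    ⊥-elim (closed (Finₚ.toℕ<n j) (subst (Walk R _ _) eq (take-walk p (suc j))))
  at-injective closed (r ◅ p) {suc i} {suc j} eq =
    cong suc (at-injective (λ j<k → closed (≤-trans j<k (n≤1+n _))) p eq)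

  -- Pigeonhole: the `k + 1` vertices of the walk are distinct.
  walk-length< : NoClosedWalk → ∀ {k u v} → Walk R k u v → k < n
  walk-length< closed p = injective⇒≤ {f = at p} (at-injective (λ _ → closed) p)

-- Acyclicity and dependence of arcs in terms of walks.

Arc : ∀ {n} → Dir n → Rel n
Arc o u v = o u v ≡ true

Irreflexive : ∀ {n} → Dir n → Set
Irreflexive o = ∀ {u} → ¬ Arc o u u

module _ {n : ℕ} {o : Dir n} where

  -- A closed walk may repeat vertices and a `DirCycle` may not, so a shortest closed walk is taken:
  -- its vertices are distinct. Irreflexivity rules out length one, which `DirCycle` does not cover.
  acyclic⇒no-closed-walk : Irreflexive o → Acyclic o → NoClosedWalk {R = Arc o}
  acyclic⇒no-closed-walk irr acyc {k} = shorter k ≤-refl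
    where
    shorter : ∀ m {k u} → k ≤ m → ¬ Walk (Arc o) (suc k) u u
    shorter m {zero} _ (r ◅ ε) = irr r
    shorter (suc m) {suc k} (s≤s k≤m) (r ◅ p) = acyc record
      { m = suc k
      ; m≥1 = s≤s z≤n
      ; w = at p
      ; inj = λ _ _ → at-injective (λ j<k → shorter m (≤-trans (s≤s⁻¹ j<k) k≤m)) p
      ; step = at-step p
      ; close = λ { i i≡m zero refl → subst (λ x → Arc o x _) (sym (at-last p i i≡m)) r }
      }

  tour : ∀ m (w : Fin (suc m) → Fin n) →
         (∀ i j → suc (toℕ i) ≡ toℕ j → Arc o (w i) (w j)) →
         ∃ λ i → toℕ i ≡ m × Walk (Arc o) m (w zero) (w i)
  tour zero w step = zero , refl , ε
  tour (suc m) w step with tour m (w ∘ suc) (λ i j eq → step (suc i) (suc j) (cong suc eq))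
  ... | i , eq , p = suc i , cong suc eq , step zero (suc zero) refl ◅ p

  cycle⇒closed-walk : DirCycle o → ∃₂ λ k u → Walk (Arc o) (suc k) u u
  cycle⇒closed-walk c with tour (DirCycle.m c) (DirCycle.w c) (DirCycle.step c)
  ... | i , i≡m , p = DirCycle.m c , _ , DirCycle.close c i i≡m zero refl ◅ p

module _ {n : ℕ} (o : Dir n) (u v : Fin n) where

  ArcExcept : Rel n
  ArcExcept x y = Arc o x y × ¬ (x ≡ u × y ≡ v)

  reverseArc-arc : ∀ {x y} → Arc (reverseArc o u v) x y → (x ≡ v × y ≡ u) ⊎ ArcExcept x y
  reverseArc-arc {x} {y} with x Finₚ.≟ u | y Finₚ.≟ v | x Finₚ.≟ v | y Finₚ.≟ u
  ... | yes _ | yes _ | _ | _ = λ ()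
  ... | yes _ | no ¬q | yes p | yes q = λ _ → inj₁ (p , q)
  ... | yes _ | no ¬q | yes _ | no _ = λ a → inj₂ (a , ¬q ∘ proj₂)
  ... | yes _ | no ¬q | no _ | _ = λ a → inj₂ (a , ¬q ∘ proj₂)
  ... | no ¬p | _ | yes p | yes q = λ _ → inj₁ (p , q)
  ... | no ¬p | _ | yes _ | no _ = λ a → inj₂ (a , ¬p ∘ proj₁)
  ... | no ¬p | _ | no _ | _ = λ a → inj₂ (a , ¬p ∘ proj₁)

  -- A walk using the reversed arc is cut after its last and before its first use of it.
  cut-walk : ∀ {k x y} → Walk (Arc (reverseArc o u v)) k x y →
    Walk ArcExcept k x y ⊎ (∃ λ i → ∃ λ j → Walk ArcExcept i x v × Walk ArcExcept j u y)
  cut-walk ε = inj₁ ε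
  cut-walk (r ◅ p) with reverseArc-arc r | cut-walk p
  ... | inj₂ a | inj₁ q = inj₁ (a ◅ q)
  ... | inj₂ a | inj₂ (i , j , q₁ , q₂) = inj₂ (suc i , j , a ◅ q₁ , q₂)
  ... | inj₁ (refl , refl) | inj₁ q = inj₂ (0 , _ , ε , q)
  ... | inj₁ (refl , refl) | inj₂ (_ , j , _ , q₂) = inj₂ (0 , j , ε , q₂)

map-walk : ∀ {n} {R S : Rel n} → (∀ {x y} → R x y → S x y) → ∀ {k x y} → Walk R k x y → Walk S k x y
map-walk f ε = ε
map-walk f (r ◅ p) = f r ◅ map-walk f p

-- The cycle created by reversing `u → v` must use the arc `v → u`, as `o` has no closed walk. The
-- rest of it leads from `u` to `v` without the arc itself, so it has at least two steps.
detour : ∀ {n} {o : Dir n} {u v} → Irreflexive o → NoClosedWalk {R = Arc o} →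
         Dependent o u v → ∃ λ k → Walk (Arc o) (2 + k) u v
detour {o = o} {u} {v} irr closed (uv , c) with cycle⇒closed-walk c
... | k , x , p with cut-walk o u v p
... | inj₁ q = contradiction (map-walk proj₁ q) closed
-- The pieces `u` to `x` and `x` to `v` are joined at the base point `x` of the cycle.
... | inj₂ (i , j , q₁ , q₂) with j + i | q₂ ◅◅ q₁
... | zero | ε = contradiction uv irr
... | suc zero | (_ , ¬uv) ◅ ε = contradiction (refl , refl) ¬uv
... | suc (suc m) | q = m , map-walk proj₁ q

triangle⇒dependent : ∀ {n} {o : Dir n} {x y z} → Irreflexive o →
                     Arc o x z → Arc o z y → Arc o x y → Dependent o x y
triangle⇒dependent {n} {o} {x} {y} {z} irr xz zy xy = xy , record
  { m = 2 ; m≥1 = s≤s z≤n ; w = w ; inj = inj ; step = step ; close = close }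
  where
  x≢y : x ≢ y
  x≢y refl = irr xy
  x≢z : x ≢ z
  x≢z refl = irr xz
  z≢y : z ≢ y
  z≢y refl = irr zy
  w : Fin 3 → Fin n
  w zero = x
  w (suc zero) = z
  w (suc (suc zero)) = y
  inj : ∀ i j → w i ≡ w j → i ≡ j
  inj zero zero _ = refl
  inj zero (suc zero) eq = contradiction eq x≢z
  inj zero (suc (suc zero)) eq = contradiction eq x≢y
  inj (suc zero) zero eq = contradiction (sym eq) x≢z
  inj (suc zero) (suc zero) _ = refl
  inj (suc zero) (suc (suc zero)) eq = contradiction eq z≢y
  inj (suc (suc zero)) zero eq = contradiction (sym eq) x≢y
  inj (suc (suc zero)) (suc zero) eq = contradiction (sym eq) z≢y
  inj (suc (suc zero)) (suc (suc zero)) _ = refl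
  arc-yx : Arc (reverseArc o x y) y x
  arc-yx with y Finₚ.≟ x | x Finₚ.≟ y | y Finₚ.≟ y | x Finₚ.≟ x
  ... | yes p | _ | _ | _ = contradiction (sym p) x≢y
  ... | no _ | _ | yes _ | yes _ = refl
  ... | no _ | _ | no q | _ = contradiction refl q
  ... | no _ | _ | yes _ | no q = contradiction refl q
  arc-xz : Arc (reverseArc o x y) x z
  arc-xz with x Finₚ.≟ x | z Finₚ.≟ y | x Finₚ.≟ y
  ... | _ | yes p | _ = contradiction p z≢y
  ... | _ | _ | yes p = contradiction p x≢y
  ... | yes _ | no _ | no _ = xz
  ... | no _ | no _ | no _ = xz
  arc-zy : Arc (reverseArc o x y) z y
  arc-zy with z Finₚ.≟ x | z Finₚ.≟ y
  ... | yes p | _ = contradiction (sym p) x≢z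
  ... | _ | yes p = contradiction p z≢y
  ... | no _ | no _ = zy
  step : ∀ i j → suc (toℕ i) ≡ toℕ j → Arc (reverseArc o x y) (w i) (w j)
  step zero (suc zero) _ = arc-xz
  step (suc zero) (suc (suc zero)) _ = arc-zy
  close : ∀ i → toℕ i ≡ 2 → ∀ j → toℕ j ≡ 0 → Arc (reverseArc o x y) (w i) (w j)
  close (suc (suc zero)) _ zero _ = arc-yx

-- Lists with two entries per element, and complements of lists of pairs.

length-concatMap₂ : ∀ {A B : Set} (f g : A → B) xs →
                    length (concatMap (λ x → f x ∷ g x ∷ []) xs) ≡ length xs * 2
length-concatMap₂ f g [] = refl
length-concatMap₂ f g (x ∷ xs) = cong (2 +_) (length-concatMap₂ f g xs)

∈-concatMap₂ : ∀ {A B : Set} (f g : A → B) {x xs} → x ∈ xs → ∀ {y} → y ≡ f x ⊎ y ≡ g x →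
               y ∈ concatMap (λ x → f x ∷ g x ∷ []) xs
∈-concatMap₂ f g {x} x∈xs eq = ∈-concatMap⁺ (λ x → f x ∷ g x ∷ []) (lose x∈xs (member eq))
  where
  member : ∀ {y} → y ≡ f x ⊎ y ≡ g x → y ∈ f x ∷ g x ∷ []
  member (inj₁ p) = here p
  member (inj₂ p) = there (here p)

infix 4 _∈?_

_≟ₚ_ : ∀ {n} (p q : Fin n × Fin n) → Dec (p ≡ q)
_≟ₚ_ = ≡-dec Finₚ._≟_ Finₚ._≟_

_∈?_ : ∀ {n} (p : Fin n × Fin n) l → Dec (p ∈ l)
_∈?_ = DecMembership._∈?_ _≟ₚ_

complement-length : ∀ {n} {l A : List (Fin n × Fin n)} → Unique l → l ⊆ A →
                    length l + length (filter (∁? (_∈? l)) A) ≤ length A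
complement-length {l = l} {A} ul l⊆A = ≤-trans
  (+-monoˡ-≤ _ (unique-⊆-length ul (λ p∈l → ∈-filter⁺ (_∈? l) (l⊆A p∈l) p∈l)))
  (≤-reflexive (length-filter-split (_∈? l) A))

-- Adjacency in the square of a cycle.

module CycleSquare (n : ℕ) (n≥7 : 7 ≤ n) where

  instance
    n-nonZero : NonZero n
    n-nonZero = ℕ.>-nonZero (≤-trans (s≤s z≤n) n≥7)

  G : Rel n
  G = square (cycleAdj n)

  abstract
    N : Fin n → Fin n
    N u = fromℕ< (m%n<n (suc (toℕ u)) n)

    toℕ-N-% : ∀ u → toℕ (N u) ≡ suc (toℕ u) % n
    toℕ-N-% u = toℕ-fromℕ< _

  N^ : ℕ → Fin n → Fin n
  N^ zero u = u
  N^ (suc k) u = N (N^ k u)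

  toℕ-N : ∀ u → (toℕ (N u) ≡ suc (toℕ u)) ⊎ (suc (toℕ u) ≡ n × toℕ (N u) ≡ 0)
  toℕ-N u with ℕₚ.m≤n⇒m<n∨m≡n (toℕ<n u)
  ... | inj₁ lt = inj₁ (trans (toℕ-N-% u) (m<n⇒m%n≡m lt))
  ... | inj₂ eq = inj₂ (eq , trans (toℕ-N-% u) (trans (cong (_% n) eq) (n%n≡0 n)))

  toℕ-N^ : ∀ k u → toℕ (N^ k u) ≡ (k + toℕ u) % n
  toℕ-N^ zero u = sym (m<n⇒m%n≡m (toℕ<n u))
  toℕ-N^ (suc k) u = trans (toℕ-N-% (N^ k u)) (trans (cong (λ x → suc x % n) (toℕ-N^ k u))
    (trans (%-distribˡ-+ 1 ((k + toℕ u) % n) n)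
    (trans (cong (λ x → (1 % n + x) % n) (m%n%n≡m%n (k + toℕ u) n)) (sym (%-distribˡ-+ 1 (k + toℕ u) n)))))

  -- Without passing the end of the numbering, the position grows by `k`; passing it once, the
  -- position changes by `k` minus `n`. Neither change is zero.
  N^-no-fixpoint : ∀ k u → 0 < k → k < n → u ≢ N^ k u
  N^-no-fixpoint k u 0<k k<n eq with ℕₚ.<-≤-connex (k + toℕ u) n
  ... | inj₁ lt = ℕₚ.<-irrefl (trans (cong toℕ eq) (trans (toℕ-N^ k u) (m<n⇒m%n≡m lt)))
                    (ℕₚ.+-monoˡ-≤ (toℕ u) 0<k)
  ... | inj₂ ge with ℕₚ.m≤n⇒∃[o]m+o≡n ge
  ... | o , n+o≡ = ℕₚ.<-irrefl (ℕₚ.+-cancelʳ-≡ (toℕ u) k n (trans (sym n+o≡) (cong (n +_) o≡u))) k<n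
    where
    o<n : o < n
    o<n = ℕₚ.+-cancelˡ-< n _ _ (subst (_< n + n) (sym n+o≡) (ℕₚ.+-mono-< k<n (toℕ<n u)))
    o≡u : o ≡ toℕ u
    o≡u = sym (trans (cong toℕ eq) (trans (toℕ-N^ k u) (trans (cong (_% n) (trans (sym n+o≡) (+-comm n o)))
            (trans ([m+n]%n≡m%n o n) (m<n⇒m%n≡m o<n)))))

  u≢N : ∀ {u} → u ≢ N u
  u≢N {u} = N^-no-fixpoint 1 u (s≤s z≤n) (≤-trans (m≤m+n 2 5) n≥7)

  u≢N² : ∀ {u} → u ≢ N (N u)
  u≢N² {u} = N^-no-fixpoint 2 u (s≤s z≤n) (≤-trans (m≤m+n 3 4) n≥7)

  u≢N³ : ∀ {u} → u ≢ N (N (N u))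
  u≢N³ {u} = N^-no-fixpoint 3 u (s≤s z≤n) (≤-trans (m≤m+n 4 3) n≥7)

  u≢N⁴ : ∀ {u} → u ≢ N (N (N (N u)))
  u≢N⁴ {u} = N^-no-fixpoint 4 u (s≤s z≤n) (≤-trans (m≤m+n 5 2) n≥7)

  N-injective : ∀ {u v} → N u ≡ N v → u ≡ v
  N-injective {u} {v} eq with toℕ-N u | toℕ-N v
  ... | inj₁ p | inj₁ q = toℕ-injective (ℕₚ.suc-injective (trans (sym p) (trans (cong toℕ eq) q)))
  ... | inj₂ (p , _) | inj₂ (q , _) = toℕ-injective (ℕₚ.suc-injective (trans p (sym q)))
  ... | inj₁ p | inj₂ (_ , q) with () ← trans (sym p) (trans (cong toℕ eq) q)
  ... | inj₂ (_ , p) | inj₁ q with () ← trans (sym p) (trans (cong toℕ eq) q)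

  N-step : ∀ u → cycleStep n u (N u)
  N-step u with toℕ-N u
  ... | inj₁ p = inj₁ p
  ... | inj₂ (p , q) = inj₂ (cong ℕ.pred p , q)

  step⇒N : ∀ {u v} → cycleStep n u v → v ≡ N u
  step⇒N {u} {v} s with toℕ-N u
  step⇒N (inj₁ p) | inj₁ q = toℕ-injective (trans p (sym q))
  step⇒N {u} {v} (inj₁ p) | inj₂ (q , _) = contradiction (toℕ<n v) (ℕₚ.<-irrefl (trans p q))
  step⇒N {u} (inj₂ (p , _)) | inj₁ q = contradiction (toℕ<n (N u)) (ℕₚ.<-irrefl
    (trans q (trans (cong suc p) (ℕₚ.m+[n∸m]≡n (≤-trans (s≤s z≤n) n≥7)))))
  step⇒N (inj₂ (_ , p)) | inj₂ (_ , q) = toℕ-injective (trans p (sym q))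

  -- Adjacency in the square, read in the direction of increasing indices around the rim; an edge is
  -- `Near` in one of its two directions.
  Near : Rel n
  Near u v = v ≡ N u ⊎ v ≡ N (N u)

  near? : ∀ u v → Dec (Near u v ⊎ Near v u)
  near? u v = ((v Finₚ.≟ N u) ⊎-dec (v Finₚ.≟ N (N u))) ⊎-dec ((u Finₚ.≟ N v) ⊎-dec (u Finₚ.≟ N (N v)))

  -- Two rim steps in the same direction give a chord; two in opposite directions return to the
  -- start, which `u ≢ v` excludes.
  adjacent⇒near : ∀ {u v} → G u v → Near u v ⊎ Near v u
  adjacent⇒near (_ , inj₁ (inj₁ s)) = inj₁ (inj₁ (step⇒N s))
  adjacent⇒near (_ , inj₁ (inj₂ s)) = inj₂ (inj₁ (step⇒N s))
  adjacent⇒near (u≢v , inj₂ (w , p , q)) with Sum.map step⇒N step⇒N p | Sum.map step⇒N step⇒N q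
  ... | inj₁ refl | inj₁ refl = inj₁ (inj₂ refl)
  ... | inj₁ refl | inj₂ eq = contradiction (N-injective eq) u≢v
  ... | inj₂ refl | inj₁ refl = contradiction refl u≢v
  ... | inj₂ refl | inj₂ refl = inj₂ (inj₂ refl)

  near⇒adjacent : ∀ {u v} → Near u v → G u v × G v u
  near⇒adjacent {u} (inj₁ refl) =
    (u≢N , inj₁ (inj₁ (N-step u))) , (u≢N ∘ sym , inj₁ (inj₂ (N-step u)))
  near⇒adjacent {u} (inj₂ refl) =
    (u≢N² , inj₂ (N u , inj₁ (N-step u) , inj₁ (N-step (N u)))) ,
    (u≢N² ∘ sym , inj₂ (N u , inj₂ (N-step (N u)) , inj₂ (N-step u)))

  -- Upper bound on the number of dependent arcs.

  module Oriented {o : Dir n} (orient : IsOrientation G o) (acyc : Acyclic o) where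

    arc⇒near : ∀ {u v} → Arc o u v → Near u v ⊎ Near v u
    arc⇒near {u} {v} uv with near? u v
    ... | yes near = near
    ... | no ¬near with () ← trans (sym uv) (proj₂ orient u v (¬near ∘ adjacent⇒near))

    irr : Irreflexive o
    irr {u} uu with () ← trans (sym uu) (proj₂ orient u u (λ (u≢u , _) → u≢u refl))

    closed : NoClosedWalk {R = Arc o}
    closed = acyclic⇒no-closed-walk irr acyc

    near-arc : ∀ {u v} → Near u v → Arc o u v ⊎ Arc o v u
    near-arc {u} {v} near with proj₁ orient u v (proj₁ (near⇒adjacent near))
    ... | inj₁ (p , _) = inj₁ p
    ... | inj₂ (_ , p) = inj₂ p

    arc-asym : ∀ {u v} → Arc o u v → ¬ Arc o v u
    arc-asym p q = closed (p ◅ q ◅ ε)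

    directed : Fin n → Fin n → Fin n × Fin n
    directed u v = if o u v then (u , v) else (v , u)

    directed-forward : ∀ {u v} → Arc o u v → (u , v) ≡ directed u v
    directed-forward uv rewrite uv = refl

    directed-backward : ∀ {u v} → Arc o u v → (u , v) ≡ directed v u
    directed-backward {u} {v} uv with o v u in vu
    ... | true = contradiction vu (arc-asym uv)
    ... | false = refl

    -- Each vertex contributes the edges one and two steps ahead of it, so `2n` pairs cover all
    -- arcs.
    arcs : List (Fin n × Fin n)
    arcs = concatMap (λ u → directed u (N u) ∷ directed u (N (N u)) ∷ []) (allFin n)

    length-arcs : length arcs ≡ n * 2
    length-arcs = trans (length-concatMap₂ _ _ (allFin n)) (cong (_* 2) (length-tabulate {n = n} (λ i → i)))

    arc∈arcs : ∀ {u v} → Arc o u v → (u , v) ∈ arcs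
    arc∈arcs {u} {v} uv with arc⇒near uv
    ... | inj₁ (inj₁ refl) = ∈-concatMap₂ _ _ (∈-allFin u) (inj₁ (directed-forward uv))
    ... | inj₁ (inj₂ refl) = ∈-concatMap₂ _ _ (∈-allFin u) (inj₂ (directed-forward uv))
    ... | inj₂ (inj₁ refl) = ∈-concatMap₂ _ _ (∈-allFin v) (inj₁ (directed-backward uv))
    ... | inj₂ (inj₂ refl) = ∈-concatMap₂ _ _ (∈-allFin v) (inj₂ (directed-backward uv))

    module Counted {l : List (Fin n × Fin n)} (ul : Unique l)
                   (l⇔ : ∀ p → p ∈ l ⇔ Dependent o (proj₁ p) (proj₂ p)) where

      dependent : ∀ {u v} → (u , v) ∈ l → Dependent o u v
      dependent = Equivalence.to (l⇔ _)

      listed : ∀ {u v} → Dependent o u v → (u , v) ∈ l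
      listed = Equivalence.from (l⇔ _)

      independent : List (Fin n × Fin n)
      independent = filter (∁? (_∈? l)) arcs

      -- The independent arcs connect the graph: replacing a dependent arc of a walk by its
      -- detour lengthens the walk, and walks have fewer than n steps.
      module Connected {A : Set} (f : Fin n → A)
                       (const : ∀ {u v} → (u , v) ∈ independent → f u ≡ f v) where

        lengthen : ∀ {k u v} → Walk (Arc o) k u v →
                   f u ≡ f v ⊎ ∃ λ k′ → k < k′ × Walk (Arc o) k′ u v
        lengthen ε = inj₁ refl
        lengthen (_◅_ {u = u} {v = w} r p) with (u , w) ∈? l
        ... | yes uw∈l with detour irr closed (dependent uw∈l)
        ...   | m , q = inj₂ (2 + m + _ , s≤s (s≤s (m≤n+m _ m)) , q ◅◅ p)
        lengthen (r ◅ p) | no uw∉l with lengthen p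
        ...   | inj₁ eq = inj₁ (trans (const (∈-filter⁺ (∁? (_∈? l)) (arc∈arcs r) uw∉l)) eq)
        ...   | inj₂ (k′ , k<k′ , q) = inj₂ (suc k′ , s≤s k<k′ , r ◅ q)

        -- `m` bounds the number of lengthenings still possible: at zero the walk would have at
        -- least `n` steps.
        constant-on-walk : ∀ m {k u v} → n ≤ k + m → Walk (Arc o) k u v → f u ≡ f v
        constant-on-walk zero {k} n≤k p =
          contradiction (≤-trans n≤k (≤-reflexive (+-identityʳ k))) (ℕₚ.<⇒≱ (walk-length< closed p))
        constant-on-walk (suc m) {k} n≤k+m p with lengthen p
        ... | inj₁ eq = eq
        ... | inj₂ (k′ , k<k′ , q) = constant-on-walk m
          (≤-trans n≤k+m (≤-trans (≤-reflexive (+-suc k m)) (+-monoˡ-≤ m k<k′))) q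

        constant-on-arc : ∀ {u v} → Arc o u v → f u ≡ f v
        constant-on-arc r = constant-on-walk n (m≤n+m n 1) (r ◅ ε)

        constant-on-N^ : ∀ k u → f (N^ k u) ≡ f u
        constant-on-N^ zero u = refl
        constant-on-N^ (suc k) u = trans (sym (step (N^ k u))) (constant-on-N^ k u)
          where
          step : ∀ v → f v ≡ f (N v)
          step v with near-arc (inj₁ {B = N v ≡ N (N v)} (refl {x = N v}))
          ... | inj₁ r = constant-on-arc r
          ... | inj₂ r = sym (constant-on-arc r)

        constant : ∀ u v → f u ≡ f v
        constant u v = trans (to-origin u) (sym (to-origin v))
          where
          origin : Fin n
          origin = fromℕ< (≤-trans (s≤s z≤n) n≥7)
          to-origin : ∀ w → f w ≡ f origin
          to-origin w = trans (cong f (toℕ-injective (sym eq))) (constant-on-N^ (toℕ w) origin)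
            where
            eq : toℕ (N^ (toℕ w) origin) ≡ toℕ w
            eq = trans (toℕ-N^ (toℕ w) origin) (trans (cong (λ x → (toℕ w + x) % n) (toℕ-fromℕ< _))
                   (trans (cong (_% n) (+-identityʳ (toℕ w))) (m<n⇒m%n≡m (toℕ<n w))))

      -- The merged labels are constant on the whole graph and all occur, so at most one label is
      -- left and there are at least `n - 1` independent arcs among the `2n`.
      upper-bound : length l ≤ suc n
      upper-bound with merge-labels independent
      ... | m , n≤ , f , onto , const = ℕₚ.+-cancelʳ-≤ n (length l) (suc n) (begin
        length l + n                          ≤⟨ +-monoʳ-≤ (length l) n≤ ⟩
        length l + (m + length independent)   ≤⟨ +-monoʳ-≤ (length l) (+-monoˡ-≤ _ (m≤1 m onto constant)) ⟩
        length l + suc (length independent)   ≡⟨ +-suc (length l) _ ⟩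
        suc (length l + length independent)   ≤⟨ s≤s (complement-length ul (λ p → arc∈arcs (proj₁ (dependent p)))) ⟩
        suc (length arcs)                     ≡⟨ cong suc length-arcs ⟩
        suc (n * 2)                           ≡⟨ cong suc (trans (ℕₚ.*-comm n 2) (cong (n +_) (+-identityʳ n))) ⟩
        suc n + n                             ∎)
        where
        open ℕₚ.≤-Reasoning
        open Connected f const
        m≤1 : ∀ m {f : Fin n → Fin m} → (∀ a → ∃ λ u → f u ≡ a) → (∀ u v → f u ≡ f v) → m ≤ 1
        m≤1 zero _ _ = z≤n
        m≤1 (suc zero) _ _ = ≤-refl
        m≤1 (suc (suc m)) onto const with onto zero | onto (suc zero)
        ... | u , p | v , q with () ← trans (sym p) (trans (const u v) q)

      -- Lower bound: triangles served by a dependent arc.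

      data Between (z x y : Fin n) (p : Fin n × Fin n) : Set where
        -- `z` is the middle vertex of the transitive triangle, and `p` its arc from source to sink,
        -- leaving `x` here and `y` in the other case.
        along   : Arc o x z → Arc o z y → p ≡ (x , y) → Between z x y p
        against : Arc o y z → Arc o z x → p ≡ (y , x) → Between z x y p

      -- The arc from the source to the sink of the triangle i, i+1, i+2.
      data Slot (i : Fin n) (p : Fin n × Fin n) : Set where
        lower : Between (N (N i)) i (N i) p → Slot i p
        upper : Between i (N i) (N (N i)) p → Slot i p
        outer : Between (N i) i (N (N i)) p → Slot i p

      abstract
        -- Of the eight ways to direct three edges, two are cyclic; in the other six the path
        -- through the middle vertex makes the arc from source to sink dependent.
        slot : ∀ i → ∃ λ p → p ∈ l × Slot i p
        slot i with near-arc {i} {N i} (inj₁ refl) | near-arc {N i} {N (N i)} (inj₁ refl)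
                  | near-arc {i} {N (N i)} (inj₂ refl)
        ... | inj₁ a | inj₁ b | inj₁ c = _ , listed (triangle⇒dependent irr a b c) , outer (along a b refl)
        ... | inj₁ a | inj₁ b | inj₂ c = ⊥-elim (closed (a ◅ b ◅ c ◅ ε))
        ... | inj₁ a | inj₂ b | inj₁ c = _ , listed (triangle⇒dependent irr c b a) , lower (along c b refl)
        ... | inj₁ a | inj₂ b | inj₂ c = _ , listed (triangle⇒dependent irr c a b) , upper (against c a refl)
        ... | inj₂ a | inj₁ b | inj₁ c = _ , listed (triangle⇒dependent irr a c b) , upper (along a c refl)
        ... | inj₂ a | inj₁ b | inj₂ c = _ , listed (triangle⇒dependent irr b c a) , lower (against b c refl)
        ... | inj₂ a | inj₂ b | inj₁ c = ⊥-elim (closed (a ◅ c ◅ b ◅ ε))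
        ... | inj₂ a | inj₂ b | inj₂ c = _ , listed (triangle⇒dependent irr b a c) , outer (against b a refl)

      -- A rim edge can be the lower edge of one triangle and the upper edge of the preceding one, a
      -- chord only the outer edge of one. The bit separates these two uses, so that arc and bit
      -- together determine the triangle.
      bit : ∀ {i p} → Slot i p → Bool
      bit (lower _) = true
      bit (upper _) = false
      bit (outer _) = true

      same-ends : ∀ {z x y z′ x′ y′ p} → Between z x y p → Between z′ x′ y′ p →
                  (x ≡ x′ × y ≡ y′) ⊎ (x ≡ y′ × y ≡ x′)
      same-ends (along _ _ refl) (along _ _ refl) = inj₁ (refl , refl)
      same-ends (along _ _ refl) (against _ _ refl) = inj₂ (refl , refl)
      same-ends (against _ _ refl) (along _ _ refl) = inj₂ (refl , refl)
      same-ends (against _ _ refl) (against _ _ refl) = inj₁ (refl , refl)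

      -- If a rim edge and a chord had the same ends, one or three steps around the rim would return
      -- to the start. The two lemmas on uniqueness exclude swapped ends likewise, by two and by
      -- four steps.
      lower-outer : ∀ {i j z z′ p} → Between z i (N i) p → ¬ Between z′ j (N (N j)) p
      lower-outer b c with same-ends b c
      ... | inj₁ (refl , eq) = u≢N eq
      ... | inj₂ (eq , refl) = u≢N³ eq

      upper-outer : ∀ {i j z z′ p} → Between z (N i) (N (N i)) p → ¬ Between z′ j (N (N j)) p
      upper-outer = lower-outer

      lower-unique : ∀ {i j z z′ p} → Between z i (N i) p → Between z′ j (N j) p → i ≡ j
      lower-unique b c with same-ends b c
      ... | inj₁ (eq , _) = eq
      ... | inj₂ (eq , refl) = contradiction eq u≢N²

      outer-unique : ∀ {i j z z′ p} → Between z i (N (N i)) p → Between z′ j (N (N j)) p → i ≡ j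
      outer-unique b c with same-ends b c
      ... | inj₁ (eq , _) = eq
      ... | inj₂ (eq , refl) = contradiction eq u≢N⁴

      slot-unique : ∀ {i j p} (s : Slot i p) (s′ : Slot j p) → bit s ≡ bit s′ → i ≡ j
      slot-unique (lower b) (lower c) _ = lower-unique b c
      slot-unique (lower b) (outer c) _ = contradiction c (lower-outer b)
      slot-unique (upper b) (upper c) _ = N-injective (lower-unique b c)
      slot-unique (outer b) (lower c) _ = contradiction b (lower-outer c)
      slot-unique (outer b) (outer c) _ = outer-unique b c

      slot-key : ∀ {i} → (∃ λ p → p ∈ l × Slot i p) → (Fin n × Fin n) × Bool
      slot-key (p , _ , s) = p , bit s

      key : Fin n → (Fin n × Fin n) × Bool
      key i = slot-key (slot i)

      key-injective : ∀ {i j} → key i ≡ key j → i ≡ j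
      key-injective {i} {j} = inj (slot i) (slot j)
        where
        inj : (s : ∃ λ p → p ∈ l × Slot i p) (s′ : ∃ λ p → p ∈ l × Slot j p) →
              slot-key s ≡ slot-key s′ → i ≡ j
        inj (p , _ , s) (q , _ , s′) eq with ,-injective eq
        ... | refl , b = slot-unique s s′ b

      keys : List ((Fin n × Fin n) × Bool)
      keys = map key (allFin n)

      all-keys : List ((Fin n × Fin n) × Bool)
      all-keys = concatMap (λ p → (p , true) ∷ (p , false) ∷ []) l

      ∈-all-keys : ∀ {p b} → p ∈ l → (p , b) ∈ all-keys
      ∈-all-keys {b = true} p∈l = ∈-concatMap₂ (_, true) (_, false) p∈l (inj₁ refl)
      ∈-all-keys {b = false} p∈l = ∈-concatMap₂ (_, true) (_, false) p∈l (inj₂ refl)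

      module Tight (tight : ¬ n < length l * 2) where

        -- The `n` keys are distinct, so with a missed one there would be `n + 1` distinct entries
        -- in a list of length at most `n`. Hence in the tight case every dependent arc serves two
        -- triangles.
        key-hit : ∀ {q} → q ∈ all-keys → q ∈ keys
        key-hit {q} q∈ with DecMembership._∈?_ (≡-dec _≟ₚ_ Bool._≟_) q keys
        ... | yes hit = hit
        ... | no ¬hit = contradiction (begin
          suc n           ≡⟨ cong suc (trans (length-map key (allFin n)) (length-tabulate {n = n} (λ i → i))) ⟨
          suc (length keys) ≤⟨ unique-⊆-length (Allₚ.¬Any⇒All¬ keys ¬hit ∷ Uniqueₚ.map⁺ key-injective (allFin⁺ n)) sub ⟩
          length all-keys ≡⟨ length-concatMap₂ _ _ l ⟩
          length l * 2    ∎) tight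
          where
          open ℕₚ.≤-Reasoning
          sub : q ∷ keys ⊆ all-keys
          sub (here refl) = q∈
          sub (there p) with ∈-map⁻ key p
          ... | i , _ , refl = ∈-all-keys (proj₁ (proj₂ (slot i)))

        holder : ∀ {p} b → p ∈ l → ∃ λ j → Σ (Slot j p) λ s → bit s ≡ b
        holder b p∈l with ∈-map⁻ key (key-hit (∈-all-keys p∈l))
        ... | j , _ , eq = j , of-key (slot j) eq
          where
          of-key : ∀ {i p b} (s : ∃ λ p → p ∈ l × Slot i p) → (p , b) ≡ slot-key s →
                   Σ (Slot i p) λ s → bit s ≡ b
          of-key (_ , _ , s) refl = s , refl

        -- The triangle `x`, `y`, `z` would have both `z` and `x` as its middle vertex.
        ¬lower-upper : ∀ {x y z p q} → Between z x y p → Between x y z q → ⊥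
        ¬lower-upper (along a b _) (along c d _) = closed (a ◅ b ◅ c ◅ ε)
        ¬lower-upper (along a b _) (against c d _) = arc-asym a c
        ¬lower-upper (against a b _) (along c d _) = arc-asym b d
        ¬lower-upper (against a b _) (against c d _) = closed (d ◅ a ◅ b ◅ ε)

        -- For the next triangle, `outer` is impossible because a chord cannot fill the key with bit
        -- `false`. `lower` is impossible because its edge would then also serve as the `upper` one
        -- of triangle `i`, whose slot is already `lower`.
        lower⇒upper : ∀ {i p} → Between (N (N i)) i (N i) p →
                      ∃ λ q → q ∈ l × Between (N i) (N (N i)) (N (N (N i))) q
        lower⇒upper {i} b with slot (N i)
        ... | q , q∈l , upper c = q , q∈l , c
        ... | q , q∈l , lower c with holder false q∈l
        ...   | j , upper d , _ with N-injective (lower-unique c d)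
        ...     | refl = ⊥-elim (¬lower-upper b d)
        lower⇒upper b | q , q∈l , outer c with holder false q∈l
        ...   | j , upper d , _ = ⊥-elim (upper-outer d c)

        -- The key of `q` with bit `true` is also held, and only the next triangle can hold it.
        upper⇒lower : ∀ {i q} → q ∈ l → Between i (N i) (N (N i)) q →
                      Between (N (N (N i))) (N i) (N (N i)) q
        upper⇒lower q∈l b with holder true q∈l
        ... | j , outer c , _ = ⊥-elim (upper-outer b c)
        ... | j , lower c , _ with lower-unique b c
        ...   | refl = c

        -- The two directions of a triangle whose slot is `lower`: `i → i+2 → i+1` and
        -- `i+1 → i+2 → i`.
        Ascent Descent : Fin n → Set
        Ascent i = Arc o i (N (N i)) × Arc o (N (N i)) (N i)
        Descent i = Arc o (N (N i)) i × Arc o (N i) (N (N i))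

        -- The next triangle has its middle vertex at `i+1`. The shared arc `i+2 → i+1` fixes its
        -- direction, so its slot is `i+2 → i+3`, which then also serves triangle `i+2`.
        ascent-step : ∀ {i} → Ascent i → Ascent (N (N i))
        ascent-step (a , b) with lower⇒upper (along a b refl)
        ... | q , q∈l , against c d _ = contradiction b (arc-asym d)
        ... | q , q∈l , c@(along _ _ refl) with upper⇒lower q∈l c
        ...   | along e f _ = e , f
        ...   | against _ _ eq = contradiction (proj₁ (,-injective eq)) u≢N

        descent-step : ∀ {i} → Descent i → Descent (N (N i))
        descent-step (a , b) with lower⇒upper (against b a refl)
        ... | q , q∈l , along c d _ = contradiction b (arc-asym c)
        ... | q , q∈l , c@(against _ _ refl) with upper⇒lower q∈l c
        ...   | against e f _ = f , e
        ...   | along _ _ eq = contradiction (proj₂ (,-injective eq)) u≢N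

        ascend : ∀ k {i} → Ascent i → ∃ λ j → Walk (Arc o) k i j
        ascend zero _ = _ , ε
        ascend (suc k) a with ascend k (ascent-step a)
        ... | j , p = j , proj₁ a ◅ p

        descend : ∀ k {i} → Descent i → ∃ λ j → Walk (Arc o) k j i
        descend zero _ = _ , ε
        descend (suc k) {i} d with descend k (descent-step d)
        ... | j , p = j , subst (λ m → Walk (Arc o) m j i) (+-comm k 1) (p ◅◅ (proj₁ d ◅ ε))

        -- Repeating the step gives a walk of `n` steps, too long for an acyclic orientation.
        no-lower : ∀ {i p} → ¬ Between (N (N i)) i (N i) p
        no-lower (along a b _) = ℕₚ.<-irrefl refl (walk-length< closed (proj₂ (ascend n (a , b))))
        no-lower (against a b _) = ℕₚ.<-irrefl refl (walk-length< closed (proj₂ (descend n (b , a))))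

        impossible : ⊥
        impossible with slot (fromℕ< (≤-trans (s≤s z≤n) n≥7))
        ... | _ , _ , lower b = no-lower b
        ... | _ , p∈l , upper b = no-lower (upper⇒lower p∈l b)
        ... | _ , p∈l , outer b with holder false p∈l
        ...   | _ , upper c , _ = upper-outer c b

      lower-bound : n < length l * 2
      lower-bound = ℕₚ.≰⇒> (λ le → Tight.impossible (ℕₚ.≤⇒≯ le))

-- Ranking the vertices by reversed blocks.

does-true : ∀ {P : Set} (P? : Dec P) → does P? ≡ true → P
does-true (yes p) _ = p

-- The permutation that swaps `2j` and `2j+1` for each `j < t` and fixes everything from `2t` on.
zig : ℕ → ℕ → ℕ
zig zero w = w
zig (suc t) zero = 1
zig (suc t) (suc zero) = 0
zig (suc t) (suc (suc w)) = 2 + zig t w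

zig-two : ∀ t w → zig t w < zig t (2 + w)
zig-two zero w = s≤s (n≤1+n w)
zig-two (suc t) zero = s≤s z<s
zig-two (suc t) (suc zero) = z<s
zig-two (suc t) (suc (suc w)) = s≤s (s≤s (zig-two t w))

zig-even : ∀ {t} j → j < t → zig t (j * 2) ≡ suc (j * 2)
zig-even {suc t} zero _ = refl
zig-even {suc t} (suc j) (s≤s j<t) = cong (2 +_) (zig-even j j<t)

zig-odd : ∀ {t} j → j < t → zig t (suc (j * 2)) ≡ j * 2
zig-odd {suc t} zero _ = refl
zig-odd {suc t} (suc j) (s≤s j<t) = cong (2 +_) (zig-odd j j<t)

zig-odd-even : ∀ {t} j → j < t → zig t (suc (j * 2)) < zig t (2 + j * 2)
zig-odd-even {suc t} zero _ = z<s
zig-odd-even {suc t} (suc j) (s≤s j<t) = s≤s (s≤s (zig-odd-even j j<t))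

zig-rest : ∀ t {w} → t * 2 ≤ w → zig t w ≡ w
zig-rest zero _ = refl
zig-rest (suc t) (s≤s (s≤s le)) = cong (2 +_) (zig-rest t le)

zig-zero≤1 : ∀ t → zig t 0 ≤ 1
zig-zero≤1 zero = z≤n
zig-zero≤1 (suc t) = ≤-refl

2≤zig : ∀ t w → 2 ≤ zig t (2 + w)
2≤zig zero w = s≤s (s≤s z≤n)
2≤zig (suc t) w = s≤s (s≤s z≤n)

data Place (t : ℕ) : ℕ → Set where
  even : ∀ j → j < t → Place t (j * 2)
  odd  : ∀ j → j < t → Place t (suc (j * 2))
  rest : ∀ {w} → t * 2 ≤ w → Place t w

place : ∀ t w → Place t w
place zero w = rest z≤n
place (suc t) zero = even 0 z<s
place (suc t) (suc zero) = odd 0 z<s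
place (suc t) (suc (suc w)) with place t w
... | even j j<t = even (suc j) (s≤s j<t)
... | odd j j<t = odd (suc j) (s≤s j<t)
... | rest le = rest (s≤s (s≤s le))

-- The vertices in increasing order of rank: 2, 1, 0, then the pairs (4, 3), (6, 5), …,
-- (2t+2, 2t+1), then 2t+3, 2t+4, ….
rank : ℕ → ℕ → ℕ
rank t 0 = 2
rank t 1 = 1
rank t 2 = 0
rank t (suc (suc (suc w))) = 3 + zig t w

-- The orientation with `t` blocks of size 2 and `r` singletons, on natural numbers.

module Family (t r : ℕ) (4≤ : 4 ≤ t * 2 + r) where

  n : ℕ
  n = 3 + (t * 2 + r)

  ρ : ℕ → ℕ
  ρ = rank t

  data Near : ℕ → ℕ → Set where
    one   : ∀ {x} → Near x (1 + x)
    two   : ∀ {x} → Near x (2 + x)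
    wrap₁ : ∀ {y} → 1 + y ≡ n → Near 0 y
    wrap₂ : ∀ {y} → 2 + y ≡ n → Near 0 y
    wrap₃ : ∀ {y} → 1 + y ≡ n → Near 1 y

  _⇒_ : ℕ → ℕ → Set
  x ⇒ y = ρ x < ρ y × (Near x y ⊎ Near y x)

  -- What depends on whether the last block is a pair or a singleton: `z` is the higher ranked of
  -- the last two vertices and `z′` the other, `a` is the number of rungs below `n` and `b` that of
  -- chords.
  record Ends : Set where
    field
      z z′ a b : ℕ
      z-last : (1 + z ≡ n) ⊎ (2 + z ≡ n)
      z′-last : (1 + z′ ≡ n) ⊎ (2 + z′ ≡ n)
      z′⇒z : z′ ⇒ z
      only-z : ∀ {y} → (1 + y ≡ n) ⊎ (2 + y ≡ n) → y ≡ z ⊎ y ≡ z′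
      a+b : a + b ≡ t + r
      a⁺ : ∀ {j} → j ≤ t → 3 + j * 2 < n → j < a
      a⁻ : ∀ {j} → j < a → j ≤ t × 3 + j * 2 < n
      b⁺ : ∀ {i} → 4 + (t * 2 + i) < n → i < b
      b⁻ : ∀ {i} → i < b → 4 + (t * 2 + i) < n

  ρ-two : ∀ x → ρ (1 + x) < ρ (3 + x)
  ρ-two 0 = s≤s z<s
  ρ-two 1 = z<s
  ρ-two (suc (suc w)) = s≤s (s≤s (s≤s (zig-two t w)))

  ρ-even : ∀ {j} → j ≤ t → ρ (2 + j * 2) < ρ (3 + j * 2)
  ρ-even {zero} _ = z<s
  ρ-even {suc j} j<t = s≤s (s≤s (s≤s (zig-odd-even j j<t)))

  ρ-odd : ∀ {j} → j < t → ρ (3 + j * 2) ≡ suc (ρ (4 + j * 2))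
  ρ-odd {j} j<t = cong (3 +_) (trans (zig-even j j<t) (cong suc (sym (zig-odd j j<t))))

  ρ-even≤ : ∀ {j} → j ≤ t → ρ (2 + j * 2) ≤ 1 + j * 2
  ρ-even≤ {zero} _ = z≤n
  ρ-even≤ {suc j} j<t = ≤-reflexive (cong (3 +_) (zig-odd j j<t))

  ρ-rest : ∀ {w} → t * 2 ≤ w → ρ (3 + w) ≡ 3 + w
  ρ-rest le = cong (3 +_) (zig-rest t le)

  ρ-rest-one : ∀ {w} → t * 2 ≤ w → ρ (2 + w) < ρ (3 + w)
  ρ-rest-one {zero} le = z<s
  ρ-rest-one {suc w} le with ℕₚ.m≤n⇒m<n∨m≡n le
  ... | inj₁ lt rewrite zig-rest t (s≤s⁻¹ lt) | zig-rest t le = ≤-refl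
  ... | inj₂ eq = subst (λ w → ρ (2 + w) < ρ (3 + w)) eq (ρ-even ≤-refl)

  ρ-large : ∀ {y} → 3 ≤ y → 3 ≤ ρ y
  ρ-large (s≤s (s≤s (s≤s _))) = s≤s (s≤s (s≤s z≤n))

  ρ-large′ : ∀ {y} → 5 ≤ y → 5 ≤ ρ y
  ρ-large′ (s≤s (s≤s (s≤s (s≤s (s≤s {n = w} _))))) = s≤s (s≤s (s≤s (2≤zig t w)))

  last≥5 : ∀ {y} → (1 + y ≡ n) ⊎ (2 + y ≡ n) → 5 ≤ y
  last≥5 (inj₁ eq) = s≤s⁻¹ (≤-trans (n≤1+n _) (≤-trans (s≤s (s≤s (s≤s 4≤))) (≤-reflexive (sym eq))))
  last≥5 (inj₂ eq) = s≤s⁻¹ (s≤s⁻¹ (≤-trans (s≤s (s≤s (s≤s 4≤))) (≤-reflexive (sym eq))))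

  last-3 : ∀ {y} → (1 + y ≡ n) ⊎ (2 + y ≡ n) → 3 ≤ ρ y
  last-3 l = ρ-large (≤-trans (m≤m+n 3 2) (last≥5 l))

  module _ (ends : Ends) where
    open Ends ends

    -- The arcs from source to sink of the triangles. A rung with `j < t` serves the two triangles
    -- starting at `2j+1` and `2j+2`; every other arc here serves one.
    data Dep : ℕ → ℕ → Set where
      base   : Dep 2 0
      closer : ∀ {y} → 1 + y ≡ n → Dep 1 y
      jump   : Dep 0 z
      rung   : ∀ j → j ≤ t → Dep (2 + j * 2) (3 + j * 2)
      chord  : ∀ {w} → t * 2 ≤ w → Dep (2 + w) (4 + w)

    -- Reasons for having no detour of two or more steps: the rank rises by at most one, `x` ranks
    -- highest among the in-neighbours of `y`, or `y` ranks lowest among the out-neighbours of `x`.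
    -- The arc from 1 to 3 needs its own argument.
    data Ind : ℕ → ℕ → Set where
      tight   : ∀ {x y} → ρ y ≤ suc (ρ x) → Ind x y
      last    : ∀ {x y} → (∀ w → w ⇒ y → ρ w ≤ ρ x) → Ind x y
      first   : ∀ {x y} → (∀ w → x ⇒ w → ρ y ≤ ρ w) → Ind x y
      special : Ind 1 3

    first-jump : ∀ w → 0 ⇒ w → ρ z′ ≤ ρ w
    first-jump .1 (s≤s () , inj₁ one)
    first-jump .2 (() , inj₁ two)
    first-jump w (_ , inj₁ (wrap₁ eq)) with only-z (inj₁ eq)
    ... | inj₁ refl = ℕₚ.<⇒≤ (proj₁ z′⇒z)
    ... | inj₂ refl = ≤-refl
    first-jump w (_ , inj₁ (wrap₂ eq)) with only-z (inj₂ eq)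
    ... | inj₁ refl = ℕₚ.<⇒≤ (proj₁ z′⇒z)
    ... | inj₂ refl = ≤-refl
    first-jump w (_ , inj₂ (wrap₁ ()))
    first-jump w (_ , inj₂ (wrap₂ ()))

    -- Vertex `3+2j` ranks just above `4+2j`, and the vertices after `4+2j` rank higher too. The
    -- only other in-neighbours come from wrapping around; they are 0 and 1, of rank at most 2.
    last-even : ∀ {j} → j < t → ∀ w → w ⇒ (4 + j * 2) → ρ w ≤ ρ (2 + j * 2)
    last-even {j} j<t _ (lt , inj₁ one) =
      contradiction lt (ℕₚ.<⇒≯ (≤-reflexive (sym (ρ-odd j<t))))
    last-even j<t _ (lt , inj₁ two) = ≤-refl
    last-even {zero} j<t _ (lt , inj₁ (wrap₁ eq)) with s≤s (s≤s (s≤s (s≤s ()))) ← last≥5 (inj₁ eq)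
    last-even {suc j} j<t _ (lt , inj₁ (wrap₁ eq)) = s≤s (s≤s z≤n)
    last-even {zero} j<t _ (lt , inj₁ (wrap₂ eq)) with s≤s (s≤s (s≤s (s≤s ()))) ← last≥5 (inj₂ eq)
    last-even {suc j} j<t _ (lt , inj₁ (wrap₂ eq)) = s≤s (s≤s z≤n)
    last-even {zero} j<t _ (lt , inj₁ (wrap₃ eq)) with s≤s (s≤s (s≤s (s≤s ()))) ← last≥5 (inj₁ eq)
    last-even {suc j} j<t _ (lt , inj₁ (wrap₃ eq)) = s≤s z≤n
    last-even j<t _ (lt , inj₂ one) = contradiction lt (ℕₚ.<⇒≯ (ρ-even j<t))
    last-even {j} j<t _ (lt , inj₂ two) = contradiction lt (ℕₚ.<⇒≯ (ρ-two (3 + j * 2)))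

    first-odd : ∀ {j} → j < t → ∀ w → (3 + j * 2) ⇒ w → ρ (5 + j * 2) ≤ ρ w
    first-odd j<t _ (lt , inj₁ one) = contradiction lt (ℕₚ.<⇒≯ (≤-reflexive (sym (ρ-odd j<t))))
    first-odd j<t _ (lt , inj₁ two) = ≤-refl
    first-odd j<t _ (lt , inj₂ one) = contradiction lt (ℕₚ.<⇒≯ (ρ-even (ℕₚ.<⇒≤ j<t)))
    first-odd {j} j<t _ (lt , inj₂ two) = contradiction lt (ℕₚ.<⇒≯ (ρ-two (j * 2)))
    first-odd j<t _ (lt , inj₂ (wrap₁ eq)) = contradiction lt (ℕₚ.<⇒≯ (last-3 (inj₁ eq)))
    first-odd j<t _ (lt , inj₂ (wrap₂ eq)) = contradiction lt (ℕₚ.<⇒≯ (last-3 (inj₂ eq)))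
    first-odd j<t _ (lt , inj₂ (wrap₃ eq)) =
      contradiction lt (ℕₚ.<⇒≯ (≤-trans (s≤s (s≤s z≤n)) (last-3 (inj₁ eq))))

    Class : ℕ → ℕ → Set
    Class x y = ρ x < ρ y × (Dep x y ⊎ Ind x y)

    classify-jump : ∀ {y} → (1 + y ≡ n) ⊎ (2 + y ≡ n) → Class 0 y
    classify-jump l with only-z l
    ... | inj₁ refl = last-3 l , inj₁ jump
    ... | inj₂ refl = last-3 l , inj₂ (first first-jump)

    -- One case analysis serves twice: the rank inequality directs the edge, and the second
    -- component decides whether the arc is dependent.
    classify : ∀ {x y} → Near x y → Class x y ⊎ Class y x
    classify {0} one = inj₂ (≤-refl , inj₂ (tight ≤-refl))
    classify {1} one = inj₂ (≤-refl , inj₂ (tight ≤-refl))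
    classify {suc (suc w)} one with place t w
    ... | even j j<t = inj₁ (ρ-even (ℕₚ.<⇒≤ j<t) , inj₁ (rung j (ℕₚ.<⇒≤ j<t)))
    ... | odd j j<t = inj₂ (≤-reflexive (sym (ρ-odd j<t)) , inj₂ (tight (≤-reflexive (ρ-odd j<t))))
    ... | rest le with ℕₚ.m≤n⇒m<n∨m≡n le
    ...   | inj₂ refl = inj₁ (ρ-even ≤-refl , inj₁ (rung t ≤-refl))
    ...   | inj₁ (s≤s lt) = inj₁ (ρ-rest-one le ,
            inj₂ (tight (≤-reflexive (trans (ρ-rest le) (cong suc (sym (ρ-rest lt)))))))
    classify {0} two = inj₂ (z<s , inj₁ base)
    classify {1} two = inj₁ (ρ-two 0 , inj₂ special)
    classify {suc (suc w)} two with place t w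
    ... | even j j<t = inj₁ (ρ-two _ , inj₂ (last (last-even j<t)))
    ... | odd j j<t = inj₁ (ρ-two _ , inj₂ (first (first-odd j<t)))
    ... | rest le = inj₁ (ρ-two _ , inj₁ (chord le))
    classify (wrap₁ eq) = inj₁ (classify-jump (inj₁ eq))
    classify (wrap₂ eq) = inj₁ (classify-jump (inj₂ eq))
    classify (wrap₃ eq) = inj₁ (≤-trans (s≤s (s≤s z≤n)) (last-3 (inj₁ eq)) , inj₁ (closer eq))

    last<n : ∀ {y} → (1 + y ≡ n) ⊎ (2 + y ≡ n) → y < n
    last<n (inj₁ eq) = ≤-reflexive eq
    last<n (inj₂ eq) = ≤-trans (n≤1+n _) (≤-reflexive eq)

    0⇒last : ∀ {y} → (1 + y ≡ n) ⊎ (2 + y ≡ n) → 0 ⇒ y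
    0⇒last l = last-3 l , inj₁ ([ wrap₁ , wrap₂ ]′ l)

    dep-middle : ∀ {x y} → Dep x y → y < n → ∃ λ m → m < n × x ⇒ m × m ⇒ y × x ⇒ y
    dep-middle base _ = 1 , s≤s z<s , (z<s , inj₂ one) , (≤-refl , inj₂ one) , (z<s , inj₂ two)
    dep-middle (closer eq) _ = 0 , z<s , (≤-refl , inj₂ one) , 0⇒last (inj₁ eq) ,
      (≤-trans (n≤1+n 2) (last-3 (inj₁ eq)) , inj₁ (wrap₃ eq))
    dep-middle jump _ = z′ , last<n z′-last , 0⇒last z′-last , z′⇒z , 0⇒last z-last
    dep-middle (rung zero _) _ = 1 , s≤s z<s , (z<s , inj₂ one) , (ρ-two 0 , inj₁ two) , (z<s , inj₁ one)
    dep-middle (rung (suc j) j<t) lt = 3 + j * 2 , ≤-trans (m≤n+m _ 2) lt ,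
      (≤-reflexive (sym (ρ-odd j<t)) , inj₂ one) , (ρ-two (2 + j * 2) , inj₁ two) , (ρ-even j<t , inj₁ one)
    dep-middle (chord {w} le) lt = 3 + w , ≤-trans (n≤1+n _) lt ,
      (ρ-rest-one le , inj₁ one) , (ρ-rest-one (ℕₚ.m≤n⇒m≤1+n le) , inj₁ one) , (ρ-two (1 + w) , inj₁ two)

    rungs chords deps : List (ℕ × ℕ)
    rungs = map (λ j → 2 + j * 2 , 3 + j * 2) (upTo a)
    chords = map (λ i → 2 + (t * 2 + i) , 4 + (t * 2 + i)) (upTo b)
    deps = (2 , 0) ∷ (1 , ℕ.pred n) ∷ (0 , z) ∷ rungs ++ chords

    length-deps : length deps ≡ 3 + (t + r)
    length-deps = cong (3 +_) (trans (length-++ rungs) (trans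
      (cong₂ _+_ (trans (length-map _ (upTo a)) (length-upTo a)) (trans (length-map _ (upTo b)) (length-upTo b)))
      a+b))

    unique-deps : Unique deps
    unique-deps =
      ((λ ()) ∷ (λ ()) ∷ All.map (λ { (_ , 3≤y) refl → contradiction 3≤y λ () }) large) ∷
      ((λ ()) ∷ All.map (λ { (s≤s () , _) refl }) large) ∷
      All.map (λ { (() , _) refl }) large ∷
      Uniqueₚ.++⁺
        (Uniqueₚ.map⁺ (λ {i} {j} eq → ℕₚ.*-cancelʳ-≡ i j 2 (ℕₚ.+-cancelˡ-≡ 2 _ _ (proj₁ (,-injective eq)))) (upTo⁺ a))
        (Uniqueₚ.map⁺ (λ eq → ℕₚ.+-cancelˡ-≡ (2 + t * 2) _ _ (proj₁ (,-injective eq))) (upTo⁺ b))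
        disjoint
      where
      -- These bounds separate rungs and chords from the first three entries of `deps`.
      large : All (λ p → 2 ≤ proj₁ p × 3 ≤ proj₂ p) (rungs ++ chords)
      large = Allₚ.++⁺ (Allₚ.map⁺ (All.universal (λ _ → m≤m+n 2 _ , m≤m+n 3 _) (upTo a)))
                       (Allₚ.map⁺ (All.universal (λ _ → m≤m+n 2 _ , m≤m+n 3 _) (upTo b)))
      disjoint : ∀ {p} → ¬ (p ∈ rungs × p ∈ chords)
      disjoint (p , q) with ∈-map⁻ _ p | ∈-map⁻ _ q
      ... | j , _ , refl | i , _ , eq with ,-injective eq
      -- A rung joins consecutive numbers, a chord numbers two apart.
      ... | e₁ , e₂ = ℕₚ.1+n≢n (trans (sym e₂) (cong suc e₁))

    deps⁺ : ∀ {x y} → Dep x y → y < n → (x , y) ∈ deps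
    deps⁺ base _ = here refl
    deps⁺ (closer refl) _ = there (here refl)
    deps⁺ jump _ = there (there (here refl))
    deps⁺ (rung j j≤t) lt = there (there (there (∈-++⁺ˡ (∈-map⁺ _ (∈-upTo⁺ (a⁺ j≤t lt))))))
    deps⁺ (chord {w} le) lt with ℕₚ.m≤n⇒∃[o]m+o≡n le
    ... | i , refl = there (there (there (∈-++⁺ʳ rungs (∈-map⁺ _ (∈-upTo⁺ (b⁺ lt))))))

    deps⁻ : ∀ {x y} → (x , y) ∈ deps → Dep x y × x < n × y < n
    deps⁻ (here refl) = base , s≤s (s≤s (s≤s z≤n)) , s≤s z≤n
    deps⁻ (there (here refl)) = closer refl , s≤s (s≤s z≤n) , ≤-refl
    deps⁻ (there (there (here refl))) = jump , s≤s z≤n , last<n z-last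
    deps⁻ (there (there (there p))) with ∈-++⁻ rungs p
    ... | inj₁ q with ∈-map⁻ _ q
    ...   | j , j∈ , refl with a⁻ (∈-upTo⁻ j∈)
    ...     | j≤t , lt = rung j j≤t , ≤-trans (n≤1+n _) lt , lt
    deps⁻ (there (there (there p))) | inj₂ q with ∈-map⁻ _ q
    ...   | i , i∈ , refl with b⁻ (∈-upTo⁻ i∈)
    ...     | lt = chord (m≤m+n _ i) , ≤-trans (m≤n+m _ 2) lt , lt

    -- Transfer of the orientation to `Fin n`.

    open CycleSquare n (s≤s (s≤s (s≤s 4≤))) using (G; N; toℕ-N; step⇒N; near?; adjacent⇒near; near⇒adjacent)
      renaming (Near to Nearᶠ)

    toNear : ∀ {u v} → Nearᶠ u v → Near (toℕ u) (toℕ v) ⊎ Near (toℕ v) (toℕ u)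
    toNear {u} (inj₁ refl) with toℕ-N u
    ... | inj₁ eq rewrite eq = inj₁ one
    ... | inj₂ (eq , eq₀) rewrite eq₀ = inj₂ (wrap₁ eq)
    toNear {u} (inj₂ refl) with toℕ-N u | toℕ-N (N u)
    ... | inj₁ p | inj₁ q rewrite q | p = inj₁ two
    ... | inj₁ p | inj₂ (q , q₀) rewrite q₀ | p = inj₂ (wrap₂ q)
    ... | inj₂ (p , p₀) | inj₁ q rewrite q | p₀ = inj₂ (wrap₃ p)
    ... | inj₂ (p , p₀) | inj₂ (q , _) rewrite p₀ with () ← q

    fromNear : ∀ {u v x y} → Near x y → toℕ u ≡ x → toℕ v ≡ y → Nearᶠ u v ⊎ Nearᶠ v u
    fromNear one p q = inj₁ (inj₁ (step⇒N (inj₁ (trans q (cong suc (sym p))))))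
    fromNear {u} {v} {x} two p q =
      inj₁ (inj₂ (trans (step⇒N {m} (inj₁ (trans q (cong suc (sym m≡))))) (cong N (step⇒N {u} {m} (inj₁ (trans m≡ (cong suc (sym p))))))))
      where
      m<n : suc x < n
      m<n = ≤-trans (n≤1+n _) (subst (_< n) q (toℕ<n v))
      m : Fin n
      m = fromℕ< m<n
      m≡ : toℕ m ≡ suc x
      m≡ = toℕ-fromℕ< m<n
    fromNear (wrap₁ eq) p q = inj₂ (inj₁ (step⇒N (inj₂ (trans q (cong ℕ.pred eq) , p))))
    fromNear {u} {v} {x} {y} (wrap₂ eq) p q =
      inj₂ (inj₂ (trans (step⇒N {m} (inj₂ (trans m≡ (cong ℕ.pred eq) , p))) (cong N (step⇒N {v} {m} (inj₁ (trans m≡ (cong suc (sym q))))))))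
      where
      m : Fin n
      m = fromℕ< (≤-reflexive eq)
      m≡ : toℕ m ≡ suc y
      m≡ = toℕ-fromℕ< (≤-reflexive eq)
    fromNear {u} {v} (wrap₃ eq) p q =
      inj₂ (inj₂ (trans (step⇒N {zero} {u} (inj₁ p)) (cong N (step⇒N {v} {zero} (inj₂ (trans q (cong ℕ.pred eq) , refl))))))

    near⇒nearᶠ : ∀ {u v} → Near (toℕ u) (toℕ v) ⊎ Near (toℕ v) (toℕ u) → Nearᶠ u v ⊎ Nearᶠ v u
    near⇒nearᶠ (inj₁ e) = fromNear e refl refl
    near⇒nearᶠ (inj₂ e) = Sum.swap (fromNear e refl refl)

    nearᶠ⇒near : ∀ {u v} → Nearᶠ u v ⊎ Nearᶠ v u → Near (toℕ u) (toℕ v) ⊎ Near (toℕ v) (toℕ u)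
    nearᶠ⇒near (inj₁ e) = toNear e
    nearᶠ⇒near (inj₂ e) = Sum.swap (toNear e)

    abstract
      o : Dir n
      o u v = does (near? u v ×-dec (ρ (toℕ u) ℕ.<? ρ (toℕ v)))

      arc⁻ : ∀ {u v} → Arc o u v → toℕ u ⇒ toℕ v
      arc⁻ {u} {v} uv with does-true (near? u v ×-dec (ρ (toℕ u) ℕ.<? ρ (toℕ v))) uv
      ... | near , lt = lt , nearᶠ⇒near near

      arc⁺ : ∀ {u v} → toℕ u ⇒ toℕ v → Arc o u v
      arc⁺ {u} {v} (lt , near) =
        dec-true (near? u v ×-dec (ρ (toℕ u) ℕ.<? ρ (toℕ v))) (near⇒nearᶠ near , lt)

    orientation : IsOrientation G o
    orientation = oriented , λ u v ¬uv → ¬-not (λ uv →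
        ¬uv ([ proj₁ ∘ near⇒adjacent , proj₂ ∘ near⇒adjacent ]′ (near⇒nearᶠ (proj₂ (arc⁻ uv)))))
      where
      no-arc : ∀ {u v} → ρ (toℕ v) < ρ (toℕ u) → o u v ≡ false
      no-arc gt = ¬-not (λ uv → ℕₚ.<-asym gt (proj₁ (arc⁻ uv)))
      from : ∀ {u v} → Near (toℕ u) (toℕ v) ⊎ Near (toℕ v) (toℕ u) →
             Class (toℕ u) (toℕ v) ⊎ Class (toℕ v) (toℕ u)
      from (inj₁ e) = classify e
      from (inj₂ e) = Sum.swap (classify e)
      oriented : ∀ u v → G u v → (o u v ≡ true × o v u ≡ false) ⊎ (o u v ≡ false × o v u ≡ true)
      oriented u v uv with nearᶠ⇒near (adjacent⇒near uv)
      ... | near with from {u} {v} near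
      ...   | inj₁ (lt , _) = inj₁ (arc⁺ (lt , near) , no-arc lt)
      ...   | inj₂ (gt , _) = inj₂ (no-arc gt , arc⁺ (gt , Sum.swap near))

    walk-rank≤ : ∀ {k u v} → Walk (Arc o) k u v → ρ (toℕ u) ≤ ρ (toℕ v)
    walk-rank≤ ε = ≤-refl
    walk-rank≤ (e ◅ p) = ≤-trans (ℕₚ.<⇒≤ (proj₁ (arc⁻ e))) (walk-rank≤ p)

    walk-rank< : ∀ {k u v} → Walk (Arc o) (suc k) u v → ρ (toℕ u) < ρ (toℕ v)
    walk-rank< (e ◅ p) = ≤-trans (proj₁ (arc⁻ e)) (walk-rank≤ p)

    closed : NoClosedWalk {R = Arc o}
    closed p = ℕₚ.<-irrefl refl (walk-rank< p)

    irreflexive : Irreflexive o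
    irreflexive e = closed (e ◅ ε)

    acyclic : Acyclic o
    acyclic c = closed (proj₂ (proj₂ (cycle⇒closed-walk c)))

    no-detour : ∀ {k u v x y} → Ind x y → toℕ u ≡ x → toℕ v ≡ y → ¬ Walk (Arc o) (2 + k) u v
    no-detour (tight le) refl refl (e ◅ p) =
      ℕₚ.<⇒≱ (≤-trans (s≤s (proj₁ (arc⁻ e))) (walk-rank< p)) le
    no-detour (last f) refl refl p with unsnoc p
    ... | w , q , e = ℕₚ.<⇒≱ (walk-rank< q) (f (toℕ w) (arc⁻ e))
    no-detour (first f) refl refl (e ◅ p) = ℕₚ.<⇒≱ (walk-rank< p) (f _ (arc⁻ e))
    no-detour {v = v} special u≡1 v≡3 (_◅_ {v = w} e p) =
      via (subst (_⇒ toℕ w) u≡1 (arc⁻ e)) refl p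
      where
      -- The last two vertices rank at least 5, vertex 3 at most 4.
      below : ∀ {k w} → Walk (Arc o) k w v → ¬ ((1 + toℕ w ≡ n) ⊎ (2 + toℕ w ≡ n))
      below p l = ℕₚ.<⇒≱ (ρ-large′ (last≥5 l)) (≤-trans (walk-rank≤ p)
        (≤-trans (≤-reflexive (cong ρ v≡3)) (s≤s (s≤s (s≤s (zig-zero≤1 t))))))
      from-0 : ∀ {k w m} → 0 ⇒ m → toℕ w ≡ m → Walk (Arc o) k w v → ⊥
      from-0 (s≤s () , inj₁ one) _ _
      from-0 (() , inj₁ two) _ _
      from-0 (_ , inj₂ (wrap₁ ())) _ _
      from-0 (_ , inj₂ (wrap₂ ())) _ _
      from-0 (_ , inj₁ (wrap₁ l)) refl p = below p (inj₁ l)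
      from-0 (_ , inj₁ (wrap₂ l)) refl p = below p (inj₂ l)
      -- From 1 the walk goes to 3 at once and cannot return, to the last vertex, or to 0 and from
      -- there to one of the last two. The index `m` replaces `toℕ w` so that the adjacency can be
      -- matched on.
      via : ∀ {k w m} → 1 ⇒ m → toℕ w ≡ m → Walk (Arc o) (suc k) w v → ⊥
      via (_ , inj₁ two) eq p = ℕₚ.<-irrefl (cong ρ (trans eq (sym v≡3))) (walk-rank< p)
      via (_ , inj₁ (wrap₃ l)) refl p = below p (inj₁ l)
      via (_ , inj₂ (wrap₂ l)) _ _ with s≤s () ← last≥5 (inj₂ l)
      via (_ , inj₂ one) eq (_◅_ {v = w} e p) = from-0 (subst (_⇒ toℕ w) eq (arc⁻ e)) refl p

    attained : Attained G (3 + (t + r))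
    attained = o , orientation , acyclic , l , unique-l , l⇔ , trans (length-map _ deps) length-deps
      where
      -- Reduction modulo `n` only makes the map total: the entries of `deps` lie below `n`.
      ⟦_⟧ : ℕ → Fin n
      ⟦ x ⟧ = fromℕ< (m%n<n x n)
      toℕ-⟦⟧ : ∀ {x} → x < n → toℕ ⟦ x ⟧ ≡ x
      toℕ-⟦⟧ lt = trans (toℕ-fromℕ< _) (m<n⇒m%n≡m lt)
      ⟦⟧-toℕ : ∀ u → ⟦ toℕ u ⟧ ≡ u
      ⟦⟧-toℕ u = toℕ-injective (toℕ-⟦⟧ (toℕ<n u))
      l : List (Fin n × Fin n)
      l = map (λ (x , y) → ⟦ x ⟧ , ⟦ y ⟧) deps
      unique-l : Unique l
      -- Applying `toℕ` to both components of `l` gives back `deps`.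
      unique-l = Uniqueₚ.map⁻ {f = λ (u , v) → toℕ u , toℕ v} (subst Unique (sym (trans (sym (map-∘ deps)) (map-id-local
        (All.tabulate (λ p∈ → let (_ , x<n , y<n) = deps⁻ p∈ in cong₂ _,_ (toℕ-⟦⟧ x<n) (toℕ-⟦⟧ y<n)))))) unique-deps)
      listed⇒dependent : ∀ {p} → p ∈ l → Dependent o (proj₁ p) (proj₂ p)
      listed⇒dependent p∈l with ∈-map⁻ _ p∈l
      ... | (x , y) , xy∈ , refl with deps⁻ xy∈
      ...   | d , x<n , y<n with dep-middle d y<n
      ...     | m , m<n , xm , my , xy = triangle⇒dependent {z = ⟦ m ⟧} irreflexive
        (arc x<n m<n xm) (arc m<n y<n my) (arc x<n y<n xy)
        where
        arc : ∀ {x y} → x < n → y < n → x ⇒ y → Arc o ⟦ x ⟧ ⟦ y ⟧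
        arc x<n y<n e = arc⁺ (subst₂ _⇒_ (sym (toℕ-⟦⟧ x<n)) (sym (toℕ-⟦⟧ y<n)) e)
      classify-arc : ∀ {x y} → x ⇒ y → Dep x y ⊎ Ind x y
      classify-arc (lt , inj₁ e) with classify e
      ... | inj₁ (_ , c) = c
      ... | inj₂ (gt , _) = contradiction gt (ℕₚ.<-asym lt)
      classify-arc (lt , inj₂ e) with classify e
      ... | inj₁ (gt , _) = contradiction gt (ℕₚ.<-asym lt)
      ... | inj₂ (_ , c) = c
      dependent⇒listed : ∀ {u v} → Dependent o u v → (u , v) ∈ l
      dependent⇒listed {u} {v} d with classify-arc (arc⁻ (proj₁ d))
      ... | inj₁ dep = subst (_∈ l) (cong₂ _,_ (⟦⟧-toℕ u) (⟦⟧-toℕ v)) (∈-map⁺ _ (deps⁺ dep (toℕ<n v)))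
      ... | inj₂ ind = contradiction (proj₂ (detour irreflexive closed d)) (no-detour ind refl refl)
      l⇔ : ∀ p → p ∈ l ⇔ Dependent o (proj₁ p) (proj₂ p)
      l⇔ p = mk⇔ listed⇒dependent dependent⇒listed

-- For `r = 0` the last block is a reversed pair: `n - 2` outranks `n - 1`, and rung `t` would end
-- at `n`, so only `t` rungs and no chords remain. Otherwise `n - 1` is on top, with `t + 1` rungs
-- and `r - 1` chords.
ends : ∀ t r (4≤ : 4 ≤ t * 2 + r) → Family.Ends t r 4≤
ends zero zero ()
ends t@(suc t′) zero 4≤ = record
  { z = suc (t * 2 + 0) ; z′ = 2 + (t * 2 + 0) ; a = t ; b = 0
  ; z-last = inj₂ refl ; z′-last = inj₁ refl
  ; z′⇒z = subst (λ m → (2 + m) ⇒ (1 + m)) (sym (+-identityʳ (t * 2)))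
      (≤-reflexive (sym (ρ-odd {t′} ≤-refl)) , inj₂ one)
  ; only-z = λ { (inj₁ refl) → inj₂ refl ; (inj₂ refl) → inj₁ refl }
  ; a+b = refl
  ; a⁺ = λ {j} _ lt → ℕₚ.*-cancelʳ-< 2 j t (subst (j * 2 <_) (+-identityʳ (t * 2)) (ℕₚ.+-cancelˡ-< 3 _ _ lt))
  ; a⁻ = λ {j} j<t → ℕₚ.<⇒≤ j<t ,
      ℕₚ.+-monoʳ-< 3 (subst (j * 2 <_) (sym (+-identityʳ (t * 2))) (ℕₚ.*-monoˡ-< 2 j<t))
  ; b⁺ = λ {i} lt → contradiction
      (ℕₚ.+-cancelˡ-< (3 + t * 2) (suc i) 0 (subst (_< 3 + (t * 2 + 0)) (cong (3 +_) (sym (+-suc (t * 2) i))) lt)) λ ()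
  ; b⁻ = λ ()
  }
  where open Family t 0 4≤
ends t (suc r) 4≤ = record
  { z = 2 + (t * 2 + suc r) ; z′ = suc (t * 2 + suc r) ; a = suc t ; b = r
  ; z-last = inj₁ refl ; z′-last = inj₂ refl
  ; z′⇒z = subst (λ m → (1 + m) ⇒ (2 + m)) (sym (+-suc (t * 2) r)) (ρ-rest-one (m≤m+n _ r) , inj₁ one)
  ; only-z = λ { (inj₁ refl) → inj₁ refl ; (inj₂ refl) → inj₂ refl }
  ; a+b = sym (+-suc t r)
  ; a⁺ = λ j≤t _ → s≤s j≤t
  ; a⁻ = λ { (s≤s j≤t) → j≤t , ℕₚ.+-monoʳ-< 3 (ℕₚ.≤-<-trans (ℕₚ.*-monoˡ-≤ 2 j≤t) (ℕₚ.m<m+n (t * 2) z<s)) }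
  ; b⁺ = λ {i} lt → s≤s⁻¹ (ℕₚ.+-cancelˡ-< (3 + t * 2) (suc i) (suc r)
      (subst (_< 3 + (t * 2 + suc r)) (cong (3 +_) (sym (+-suc (t * 2) i))) lt))
  ; b⁻ = λ {i} lt → subst (_< 3 + (t * 2 + suc r)) (cong (3 +_) (+-suc (t * 2) i))
      (ℕₚ.+-monoʳ-< (3 + t * 2) (s≤s lt))
  }
  where open Family t (suc r) 4≤

-- Combining the bounds with the construction.

attained-value : ∀ {n k} t r → n ≡ 3 + (t * 2 + r) → k ≡ 3 + (t + r) → 7 ≤ n →
                 Attained (square (cycleAdj n)) k
attained-value t r refl refl (s≤s (s≤s (s≤s 4≤))) = Family.attained t r 4≤ (ends t r 4≤)

attained-bounds : ∀ {n k} → 7 ≤ n → Attained (square (cycleAdj n)) k → n < k * 2 × k ≤ suc n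
attained-bounds {n} n≥7 (o , orient , acyc , l , ul , l⇔ , refl) = lower-bound , upper-bound
  where
  open CycleSquare n n≥7
  open Oriented orient acyc
  open Counted ul l⇔

theorem2 : (n : ℕ) → 7 ≤ n → FullyOrientable (square (cycleAdj n))
theorem2 n n≥7 a b (att-a , _) (att-b , _) k a≤k k≤b
  with ℕₚ.m≤n⇒m<n∨m≡n a≤k | ℕₚ.m≤n⇒m<n∨m≡n k≤b
... | inj₂ refl | _ = att-a
... | inj₁ _ | inj₂ refl = att-b
... | inj₁ a<k | inj₁ k<b
  -- Since `k < b ≤ n + 1`, the number of pairs can be chosen as `t = n - k`.
  with ℕₚ.m≤n⇒∃[o]m+o≡n (s≤s⁻¹ (≤-trans k<b (proj₂ (attained-bounds n≥7 att-b))))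
... | t , k+t≡n with ℕₚ.m≤n⇒∃[o]m+o≡n 3+t≤k
  where
  open ℕₚ.≤-Reasoning
  3+t≤k : 3 + t ≤ k
  -- From `n < 2a` and `a < k` follows `n + 3 ≤ 2k`, where `n = k + t`. This leaves `r = k - 3 - t`
  -- singletons.
  3+t≤k = ℕₚ.+-cancelˡ-≤ k (3 + t) k (begin
    k + (3 + t)     ≡⟨ solve 2 (λ k t → k :+ (con 3 :+ t) := con 2 :+ (con 1 :+ (k :+ t))) refl k t ⟩
    2 + suc (k + t) ≡⟨ cong (3 +_) k+t≡n ⟩
    2 + suc n       ≤⟨ +-monoʳ-≤ 2 (proj₁ (attained-bounds n≥7 att-a)) ⟩
    suc a * 2       ≤⟨ ℕₚ.*-monoˡ-≤ 2 a<k ⟩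
    k * 2           ≡⟨ solve 1 (λ k → k :* con 2 := k :+ k) refl k ⟩
    k + k           ∎)
    where open +-*-Solver
... | r , refl = attained-value t r
  (trans (sym k+t≡n) (solve 2 (λ t r → con 3 :+ t :+ r :+ t := con 3 :+ (t :* con 2 :+ r)) refl t r)) refl n≥7
  where open +-*-Solver
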